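{- There exist elements $c_1,\dots,c_r$ of $\mathbb Q(R_{1,0},\dots,R_{r,1})$, independent of $n$, such that with $c_0=c_{r+1}=1$, $$\sum_{m=0}^{r+1}(-1)^m\,c_{r+1-m}\,R_{1,n+m}=0\qquad\text{for all } n\in\mathbb Z.$$
   Context: Fix an integer $r\ge1$ and let $I_r=\{1,\dots,r\}$. Let $R_{1,0},\dots,R_{r,0},R_{1,1},\dots,R_{r,1}$ be $2r$ algebraically independent indeterminates over $\mathbb Q$. The $A_r$ $Q$-system is the unique family $(R_{\alpha,n})_{0\le\alpha\le r+1,\ n\in\mathbb Z}$ of nonzero elements of $\mathbb Q(R_{1,0},\dots,R_{r,1})$ with these initial values, $R_{0,n}=R_{r+1,n}=1$ for all $n$, and $R_{\alpha,n+1}R_{\alpha,n-1}=R_{\alpha,n}^2+R_{\alpha+1,n}R_{\alpha-1,n}$ for $\alpha\in I_r$, $n\in\mathbb Z$. -}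

module Defs where

open import Algebra.Apartness.Bundles using (HeytingCommutativeRing; HeytingField)
open import Algebra.Bundles using (AbelianGroup; CommutativeRing)
open import Algebra.Definitions using (Invertible)
open import Data.Empty using (⊥-elim)
open import Data.Fin.Base using (Fin; zero; suc; fromℕ; inject₁; _↑ˡ_; _↑ʳ_)
open import Data.Integer.Base as ℤ using (ℤ; 0ℤ; 1ℤ)
open import Data.List.Base using (List; []; _∷_; map)
open import Data.Nat.Base as ℕ using (ℕ; zero; suc)
open import Data.Product.Base using (_,_)
open import Data.Rational.Base as ℚ using (ℚ)
import Data.Rational.Properties as ℚ
open import Data.Sum.Base using (_⊎_; inj₁; inj₂)
import Data.Sum.Base as Sum
open import Function.Base using (_∘_)
open import Level using (0ℓ)
open import Relation.Binary.PropositionalEquality as ≡ using (_≡_)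
open import Relation.Nullary using (¬_; Dec; yes; no)
open import Relation.Nullary.Decidable using (decidable-stable; map′)
import Algebra.Properties.CommutativeSemigroup as CommutativeSemigroupProperties
import Algebra.Properties.Group as GroupProperties
import Algebra.Properties.Ring as RingProperties
import Algebra.Properties.Semiring.Exp as SemiringExp
import Algebra.Properties.Semiring.Sum as SemiringSum
import Algebra.Solver.Ring.NaturalCoefficients.Default as SemiringSolver
import Relation.Binary.Reasoning.Setoid as SetoidReasoning

record IntegralDomain : Set₁ where
  field
    commutativeRing : CommutativeRing 0ℓ 0ℓ

  open CommutativeRing commutativeRing public

  field
    1≉0            : ¬ 1# ≈ 0#
    _≈0?           : ∀ x → Dec (x ≈ 0#)
    noZeroDivisors : ∀ x y → x * y ≈ 0# → x ≈ 0# ⊎ y ≈ 0#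

ℚ-domain : IntegralDomain
ℚ-domain = record
  { commutativeRing = ℚ.+-*-commutativeRing
  ; 1≉0             = λ ()
  ; _≈0?            = ℚ._≟ ℚ.0ℚ
  ; noZeroDivisors  = λ x y xy≡0 → helper x y xy≡0 (x ℚ.≟ ℚ.0ℚ)
  }
  where
  open ≡.≡-Reasoning
  helper : ∀ x y → x ℚ.* y ≡ ℚ.0ℚ → Dec (x ≡ ℚ.0ℚ) → x ≡ ℚ.0ℚ ⊎ y ≡ ℚ.0ℚ
  helper x y xy≡0 (yes x≡0) = inj₁ x≡0
  helper x y xy≡0 (no x≢0)  = inj₂ (begin
    y                       ≡⟨ ℚ.*-identityˡ y ⟨
    ℚ.1ℚ ℚ.* y              ≡⟨ ≡.cong (ℚ._* y) (ℚ.*-inverseˡ x) ⟨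
    (ℚ.1/ x) ℚ.* x ℚ.* y    ≡⟨ ℚ.*-assoc (ℚ.1/ x) x y ⟩
    (ℚ.1/ x) ℚ.* (x ℚ.* y)  ≡⟨ ≡.cong ((ℚ.1/ x) ℚ.*_) xy≡0 ⟩
    (ℚ.1/ x) ℚ.* ℚ.0ℚ       ≡⟨ ℚ.*-zeroʳ (ℚ.1/ x) ⟩
    ℚ.0ℚ                    ∎)
    where instance _ = ℚ.≢-nonZero x≢0

-- The polynomial ring D[X].  A polynomial is its list of coefficients, constant
-- coefficient first; trailing zeros are allowed and ignored by _≈ₚ_.

module Polynomial (D : IntegralDomain) where

  open IntegralDomain D renaming (refl to ≈-refl; sym to ≈-sym; trans to ≈-trans)
  open RingProperties ring using (-0#≈0#)

  Poly : Set
  Poly = List Carrier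

  coeff : Poly → ℕ → Carrier
  coeff []      _       = 0#
  coeff (a ∷ p) zero    = a
  coeff (a ∷ p) (suc k) = coeff p k

  infix 4 _≈ₚ_
  record _≈ₚ_ (p q : Poly) : Set where
    constructor coeffwise
    field
      at : ∀ k → coeff p k ≈ coeff q k
  open _≈ₚ_ public

  infixl 6 _+ₚ_
  _+ₚ_ : Poly → Poly → Poly
  []      +ₚ q       = q
  (a ∷ p) +ₚ []      = a ∷ p
  (a ∷ p) +ₚ (b ∷ q) = (a + b) ∷ (p +ₚ q)

  -ₚ_ : Poly → Poly
  -ₚ_ = map (-_)

  infixr 7 _·_
  _·_ : Carrier → Poly → Poly
  a · p = map (a *_) p

  infixl 7 _*ₚ_
  _*ₚ_ : Poly → Poly → Poly
  []      *ₚ q = []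
  (a ∷ p) *ₚ q = a · q +ₚ (0# ∷ p *ₚ q)

  const : Carrier → Poly
  const a = a ∷ []

  X : Poly
  X = 0# ∷ 1# ∷ []

  coeff-+ : ∀ p q k → coeff (p +ₚ q) k ≈ coeff p k + coeff q k
  coeff-+ []      q       k       = ≈-sym (+-identityˡ _)
  coeff-+ (a ∷ p) []      k       = ≈-sym (+-identityʳ _)
  coeff-+ (a ∷ p) (b ∷ q) zero    = ≈-refl
  coeff-+ (a ∷ p) (b ∷ q) (suc k) = coeff-+ p q k

  coeff-neg : ∀ p k → coeff (-ₚ p) k ≈ - coeff p k
  coeff-neg []      k       = ≈-sym -0#≈0#
  coeff-neg (a ∷ p) zero    = ≈-refl
  coeff-neg (a ∷ p) (suc k) = coeff-neg p k

  coeff-· : ∀ a p k → coeff (a · p) k ≈ a * coeff p k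
  coeff-· a []      k       = ≈-sym (zeroʳ a)
  coeff-· a (b ∷ p) zero    = ≈-refl
  coeff-· a (b ∷ p) (suc k) = coeff-· a p k

  +-abelianGroupₚ : AbelianGroup 0ℓ 0ℓ
  +-abelianGroupₚ = record
    { Carrier = Poly ; _≈_ = _≈ₚ_ ; _∙_ = _+ₚ_ ; ε = [] ; _⁻¹ = -ₚ_
    ; isAbelianGroup = record
      { isGroup = record
        { isMonoid = record
          { isSemigroup = record
            { isMagma = record
              { isEquivalence = record
                { refl  = coeffwise λ k → ≈-refl
                ; sym   = λ e → coeffwise λ k → ≈-sym (at e k)
                ; trans = λ e f → coeffwise λ k → ≈-trans (at e k) (at f k)
                }
              ; ∙-cong = λ {p} {p′} {q} {q′} e f → coeffwise λ k →
                  ≈-trans (coeff-+ p q k) (≈-trans (+-cong (at e k) (at f k)) (≈-sym (coeff-+ p′ q′ k)))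
              }
            ; assoc = λ p q s → coeffwise λ k →
                ≈-trans (coeff-+ (p +ₚ q) s k) (≈-trans (+-congʳ (coeff-+ p q k))
                (≈-trans (+-assoc _ _ _)
                (≈-sym (≈-trans (coeff-+ p (q +ₚ s) k) (+-congˡ (coeff-+ q s k))))))
            }
          ; identity = (λ p → coeffwise λ k → ≈-refl)
                     , (λ p → coeffwise λ k → ≈-trans (coeff-+ p [] k) (+-identityʳ _))
          }
        ; inverse = (λ p → coeffwise λ k →
                      ≈-trans (coeff-+ (-ₚ p) p k) (≈-trans (+-congʳ (coeff-neg p k)) (-‿inverseˡ _)))
                  , (λ p → coeffwise λ k →
                      ≈-trans (coeff-+ p (-ₚ p) k) (≈-trans (+-congˡ (coeff-neg p k)) (-‿inverseʳ _)))
        ; ⁻¹-cong = λ {p} {q} e → coeffwise λ k →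
            ≈-trans (coeff-neg p k) (≈-trans (-‿cong (at e k)) (≈-sym (coeff-neg q k)))
        }
      ; comm = λ p q → coeffwise λ k →
          ≈-trans (coeff-+ p q k) (≈-trans (+-comm _ _) (≈-sym (coeff-+ q p k)))
      }
    }

  private
    module P = AbelianGroup +-abelianGroupₚ
    open CommutativeSemigroupProperties P.commutativeSemigroup using (interchange)
    open SetoidReasoning P.setoid

    ∷-cong : ∀ {a b p q} → a ≈ b → p ≈ₚ q → a ∷ p ≈ₚ b ∷ q
    ∷-cong e f = coeffwise λ { zero → e ; (suc k) → at f k }

    0∷[]≈[] : 0# ∷ [] ≈ₚ []
    0∷[]≈[] = coeffwise λ { zero → ≈-refl ; (suc k) → ≈-refl }

    ·-cong : ∀ {a b p q} → a ≈ b → p ≈ₚ q → a · p ≈ₚ b · q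
    ·-cong {a} {b} {p} {q} e f = coeffwise λ k →
      ≈-trans (coeff-· a p k) (≈-trans (*-cong e (at f k)) (≈-sym (coeff-· b q k)))

    0·p≈[] : ∀ p → 0# · p ≈ₚ []
    0·p≈[] p = coeffwise λ k → ≈-trans (coeff-· 0# p k) (zeroˡ _)

    1·p≈p : ∀ p → 1# · p ≈ₚ p
    1·p≈p p = coeffwise λ k → ≈-trans (coeff-· 1# p k) (*-identityˡ _)

    ·-distribˡ : ∀ a p q → a · (p +ₚ q) ≈ₚ a · p +ₚ a · q
    ·-distribˡ a p q = coeffwise λ k →
      ≈-trans (coeff-· a (p +ₚ q) k) (≈-trans (*-congˡ (coeff-+ p q k))
      (≈-trans (distribˡ _ _ _)
      (≈-sym (≈-trans (coeff-+ (a · p) (a · q) k) (+-cong (coeff-· a p k) (coeff-· a q k))))))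

    ·-distribʳ : ∀ a b p → (a + b) · p ≈ₚ a · p +ₚ b · p
    ·-distribʳ a b p = coeffwise λ k →
      ≈-trans (coeff-· (a + b) p k) (≈-trans (distribʳ _ _ _)
      (≈-sym (≈-trans (coeff-+ (a · p) (b · p) k) (+-cong (coeff-· a p k) (coeff-· b p k)))))

    ·-assoc : ∀ a b p → (a * b) · p ≈ₚ a · (b · p)
    ·-assoc a b p = coeffwise λ k →
      ≈-trans (coeff-· (a * b) p k) (≈-trans (*-assoc _ _ _)
      (≈-sym (≈-trans (coeff-· a (b · p) k) (*-congˡ (coeff-· b p k)))))

    0∷-+ : ∀ p q → 0# ∷ (p +ₚ q) ≈ₚ (0# ∷ p) +ₚ (0# ∷ q)
    0∷-+ p q = ∷-cong (≈-sym (+-identityˡ 0#)) P.refl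

    ·-0∷ : ∀ a p → a · (0# ∷ p) ≈ₚ 0# ∷ a · p
    ·-0∷ a p = ∷-cong (zeroʳ a) P.refl

    *-congˡₚ : ∀ p {q s} → q ≈ₚ s → p *ₚ q ≈ₚ p *ₚ s
    *-congˡₚ []      e = P.refl
    *-congˡₚ (a ∷ p) e = P.∙-cong (·-cong ≈-refl e) (∷-cong ≈-refl (*-congˡₚ p e))

    *-zeroʳₚ : ∀ p → p *ₚ [] ≈ₚ []
    *-zeroʳₚ []      = P.refl
    *-zeroʳₚ (a ∷ p) = P.trans (∷-cong ≈-refl (*-zeroʳₚ p)) 0∷[]≈[]

    *-∷ : ∀ q a p → q *ₚ (a ∷ p) ≈ₚ a · q +ₚ (0# ∷ q *ₚ p)
    *-∷ []      a p = P.sym 0∷[]≈[]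
    *-∷ (b ∷ q) a p = ∷-cong (+-congʳ (*-comm b a)) (begin
      b · p +ₚ q *ₚ (a ∷ p)             ≈⟨ P.∙-congˡ (*-∷ q a p) ⟩
      b · p +ₚ (a · q +ₚ (0# ∷ q *ₚ p)) ≈⟨ P.assoc (b · p) (a · q) _ ⟨
      b · p +ₚ a · q +ₚ (0# ∷ q *ₚ p)   ≈⟨ P.∙-congʳ (P.comm (b · p) (a · q)) ⟩
      a · q +ₚ b · p +ₚ (0# ∷ q *ₚ p)   ≈⟨ P.assoc (a · q) (b · p) _ ⟩
      a · q +ₚ (b · p +ₚ (0# ∷ q *ₚ p)) ∎)

    *-commₚ : ∀ p q → p *ₚ q ≈ₚ q *ₚ p
    *-commₚ []      q = P.sym (*-zeroʳₚ q)
    *-commₚ (a ∷ p) q =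
      P.trans (P.∙-congˡ (∷-cong ≈-refl (*-commₚ p q))) (P.sym (*-∷ q a p))

    *-congₚ : ∀ {p p′ q q′} → p ≈ₚ p′ → q ≈ₚ q′ → p *ₚ q ≈ₚ p′ *ₚ q′
    *-congₚ {p} {p′} {q} {q′} e f = begin
      p *ₚ q   ≈⟨ *-congˡₚ p f ⟩
      p *ₚ q′  ≈⟨ *-commₚ p q′ ⟩
      q′ *ₚ p  ≈⟨ *-congˡₚ q′ e ⟩
      q′ *ₚ p′ ≈⟨ *-commₚ q′ p′ ⟩
      p′ *ₚ q′ ∎

    *-distribʳₚ : ∀ s p q → (p +ₚ q) *ₚ s ≈ₚ p *ₚ s +ₚ q *ₚ s
    *-distribʳₚ s []      q       = P.refl
    *-distribʳₚ s (a ∷ p) []      = P.sym (P.identityʳ _)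
    *-distribʳₚ s (a ∷ p) (b ∷ q) = begin
      (a + b) · s +ₚ (0# ∷ (p +ₚ q) *ₚ s)
        ≈⟨ P.∙-cong (·-distribʳ a b s)
             (P.trans (∷-cong ≈-refl (*-distribʳₚ s p q)) (0∷-+ (p *ₚ s) (q *ₚ s))) ⟩
      (a · s +ₚ b · s) +ₚ ((0# ∷ p *ₚ s) +ₚ (0# ∷ q *ₚ s))
        ≈⟨ interchange (a · s) (b · s) _ _ ⟩
      (a · s +ₚ (0# ∷ p *ₚ s)) +ₚ (b · s +ₚ (0# ∷ q *ₚ s)) ∎

    *-distribˡₚ : ∀ s p q → s *ₚ (p +ₚ q) ≈ₚ s *ₚ p +ₚ s *ₚ q
    *-distribˡₚ s p q = begin
      s *ₚ (p +ₚ q)    ≈⟨ *-commₚ s (p +ₚ q) ⟩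
      (p +ₚ q) *ₚ s    ≈⟨ *-distribʳₚ s p q ⟩
      p *ₚ s +ₚ q *ₚ s ≈⟨ P.∙-cong (*-commₚ p s) (*-commₚ q s) ⟩
      s *ₚ p +ₚ s *ₚ q ∎

    ·-*ₚ : ∀ a q s → (a · q) *ₚ s ≈ₚ a · (q *ₚ s)
    ·-*ₚ a []      s = P.refl
    ·-*ₚ a (b ∷ q) s = begin
      (a * b) · s +ₚ (0# ∷ (a · q) *ₚ s)
        ≈⟨ P.∙-cong (·-assoc a b s) (∷-cong ≈-refl (·-*ₚ a q s)) ⟩
      a · (b · s) +ₚ (0# ∷ a · (q *ₚ s))  ≈⟨ P.∙-congˡ (·-0∷ a (q *ₚ s)) ⟨
      a · (b · s) +ₚ a · (0# ∷ q *ₚ s)    ≈⟨ ·-distribˡ a (b · s) _ ⟨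
      a · (b · s +ₚ (0# ∷ q *ₚ s))        ∎

    0∷-*ₚ : ∀ p s → (0# ∷ p) *ₚ s ≈ₚ 0# ∷ p *ₚ s
    0∷-*ₚ p s = P.∙-congʳ (0·p≈[] s)

    *-assocₚ : ∀ p q s → (p *ₚ q) *ₚ s ≈ₚ p *ₚ (q *ₚ s)
    *-assocₚ []      q s = P.refl
    *-assocₚ (a ∷ p) q s = begin
      (a · q +ₚ (0# ∷ p *ₚ q)) *ₚ s         ≈⟨ *-distribʳₚ s (a · q) _ ⟩
      (a · q) *ₚ s +ₚ (0# ∷ p *ₚ q) *ₚ s
        ≈⟨ P.∙-cong (·-*ₚ a q s)
             (P.trans (0∷-*ₚ (p *ₚ q) s) (∷-cong ≈-refl (*-assocₚ p q s))) ⟩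
      a · (q *ₚ s) +ₚ (0# ∷ p *ₚ (q *ₚ s))  ∎

    *-identityˡₚ : ∀ p → const 1# *ₚ p ≈ₚ p
    *-identityˡₚ p = P.trans (P.∙-cong (1·p≈p p) 0∷[]≈[]) (P.identityʳ p)

    _≈[]? : ∀ p → Dec (p ≈ₚ [])
    []      ≈[]? = yes P.refl
    (a ∷ p) ≈[]? with a ≈0? | p ≈[]?
    ... | yes e | yes f = yes (P.trans (∷-cong e f) 0∷[]≈[])
    ... | no ¬e | _     = no λ g → ¬e (at g 0)
    ... | _     | no ¬f = no λ g → ¬f (coeffwise (at g ∘ suc))

    noZeroDivisors-∷ : ∀ a p b q → Dec (a ≈ 0#) → Dec (b ≈ 0#) →
      (p *ₚ (b ∷ q) ≈ₚ [] → p ≈ₚ [] ⊎ b ∷ q ≈ₚ []) →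
      ((a ∷ p) *ₚ q ≈ₚ [] → a ∷ p ≈ₚ [] ⊎ q ≈ₚ []) →
      (a ∷ p) *ₚ (b ∷ q) ≈ₚ [] → a ∷ p ≈ₚ [] ⊎ b ∷ q ≈ₚ []
    noZeroDivisors-∷ a p b q (yes a≈0) _ recˡ _ e =
      Sum.map₁ (λ f → P.trans (∷-cong a≈0 f) 0∷[]≈[]) (recˡ (coeffwise (at shifted ∘ suc)))
      where
      shifted : 0# ∷ p *ₚ (b ∷ q) ≈ₚ []
      shifted = P.trans (P.sym (0∷-*ₚ p (b ∷ q)))
        (P.trans (*-congₚ {0# ∷ p} {a ∷ p} {b ∷ q} {b ∷ q} (∷-cong (≈-sym a≈0) P.refl) P.refl) e)
    noZeroDivisors-∷ a p b q (no _) (yes b≈0) _ recʳ e =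
      Sum.map₂ (λ f → P.trans (∷-cong b≈0 f) 0∷[]≈[]) (recʳ (coeffwise (at shifted ∘ suc)))
      where
      shifted : 0# ∷ (a ∷ p) *ₚ q ≈ₚ []
      shifted = P.trans (P.sym (P.∙-congʳ (0·p≈[] (a ∷ p))))
        (P.trans (P.sym (*-∷ (a ∷ p) 0# q))
        (P.trans (*-congˡₚ (a ∷ p) (∷-cong (≈-sym b≈0) P.refl)) e))
    noZeroDivisors-∷ a p b q (no a≉0) (no b≉0) _ _ e = ⊥-elim (Sum.[ a≉0 , b≉0 ]
      (noZeroDivisors a b (≈-trans (≈-sym (+-identityʳ (a * b))) (at e 0))))

    noZeroDivisorsₚ : ∀ p q → p *ₚ q ≈ₚ [] → p ≈ₚ [] ⊎ q ≈ₚ []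
    noZeroDivisorsₚ []      q       _ = inj₁ P.refl
    noZeroDivisorsₚ (a ∷ p) []      _ = inj₂ P.refl
    noZeroDivisorsₚ (a ∷ p) (b ∷ q) = noZeroDivisors-∷ a p b q (a ≈0?) (b ≈0?)
      (noZeroDivisorsₚ p (b ∷ q)) (noZeroDivisorsₚ (a ∷ p) q)

  polynomialDomain : IntegralDomain
  polynomialDomain = record
    { commutativeRing = record
      { Carrier = Poly ; _≈_ = _≈ₚ_ ; _+_ = _+ₚ_ ; _*_ = _*ₚ_ ; -_ = -ₚ_ ; 0# = [] ; 1# = const 1#
      ; isCommutativeRing = record
        { isRing = record
          { +-isAbelianGroup = P.isAbelianGroup
          ; *-cong           = *-congₚ
          ; *-assoc          = *-assocₚ
          ; *-identity       = *-identityˡₚ , λ p → P.trans (*-commₚ p (const 1#)) (*-identityˡₚ p)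
          ; distrib          = *-distribˡₚ , *-distribʳₚ
          }
        ; *-comm = *-commₚ
        }
      }
    ; 1≉0            = λ e → 1≉0 (at e 0)
    ; _≈0?           = _≈[]?
    ; noZeroDivisors = noZeroDivisorsₚ
    }

module FractionField (D : IntegralDomain) where

  open IntegralDomain D renaming (refl to ≈-refl; sym to ≈-sym; trans to ≈-trans)
  open SemiringSolver commutativeSemiring using (solve; _:=_; _:+_; _:*_)
  open RingProperties ring using (-‿distribˡ-*; x[y-z]≈xy-xz)
  open GroupProperties +-group using (x∙y⁻¹≈ε⇒x≈y; x≈y⇒x∙y⁻¹≈ε)

  infix 5 _/_[_]
  record Fraction : Set where
    constructor _/_[_]
    field
      num den : Carrier
      den≉0   : ¬ den ≈ 0#
  open Fraction public

  infix 4 _≈f_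
  record _≈f_ (x y : Fraction) : Set where
    constructor cross
    field
      uncross : num x * den y ≈ num y * den x
  open _≈f_ public

  private
    *-nonzero : ∀ {a b} → ¬ a ≈ 0# → ¬ b ≈ 0# → ¬ a * b ≈ 0#
    *-nonzero {a} {b} a≉0 b≉0 e = Sum.[ a≉0 , b≉0 ] (noZeroDivisors a b e)

  infixl 6 _+f_
  _+f_ : Fraction → Fraction → Fraction
  x +f y = num x * den y + num y * den x / den x * den y [ *-nonzero (den≉0 x) (den≉0 y) ]

  infixl 7 _*f_
  _*f_ : Fraction → Fraction → Fraction
  x *f y = num x * num y / den x * den y [ *-nonzero (den≉0 x) (den≉0 y) ]

  -f_ : Fraction → Fraction
  -f x = - num x / den x [ den≉0 x ]

  fromDomain : Carrier → Fraction
  fromDomain a = a / 1# [ 1≉0 ]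

  private
    open SetoidReasoning setoid

    *-cancelˡ : ∀ {a x y} → ¬ a ≈ 0# → a * x ≈ a * y → x ≈ y
    *-cancelˡ {a} {x} {y} a≉0 e = Sum.[ ⊥-elim ∘ a≉0 , x∙y⁻¹≈ε⇒x≈y x y ]
      (noZeroDivisors a (x - y) (begin
        a * (x - y)   ≈⟨ x[y-z]≈xy-xz a x y ⟩
        a * x - a * y ≈⟨ +-congʳ e ⟩
        a * y - a * y ≈⟨ -‿inverseʳ (a * y) ⟩
        0#            ∎))

    transf : ∀ {x y z} → x ≈f y → y ≈f z → x ≈f z
    transf {a / b [ _ ]} {c / d [ d≉0 ]} {e / f [ _ ]} (cross p) (cross q) =
      cross (*-cancelˡ d≉0 (begin
        d * (a * f) ≈⟨ solve 3 (λ a d f → d :* (a :* f) := (a :* d) :* f) ≈-refl a d f ⟩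
        a * d * f   ≈⟨ *-congʳ p ⟩
        c * b * f   ≈⟨ solve 3 (λ b c f → c :* b :* f := (c :* f) :* b) ≈-refl b c f ⟩
        c * f * b   ≈⟨ *-congʳ q ⟩
        e * d * b   ≈⟨ solve 3 (λ b d e → e :* d :* b := d :* (e :* b)) ≈-refl b d e ⟩
        d * (e * b) ∎))

    +f-cong : ∀ {x x′ y y′} → x ≈f x′ → y ≈f y′ → x +f y ≈f x′ +f y′
    +f-cong {a / b [ _ ]} {a′ / b′ [ _ ]} {c / d [ _ ]} {c′ / d′ [ _ ]} (cross p) (cross q) = cross (begin
      (a * d + c * b) * (b′ * d′)
        ≈⟨ solve 6 (λ a b c d b′ d′ → (a :* d :+ c :* b) :* (b′ :* d′)
             := (a :* b′) :* (d :* d′) :+ (c :* d′) :* (b :* b′)) ≈-refl a b c d b′ d′ ⟩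
      a * b′ * (d * d′) + c * d′ * (b * b′)
        ≈⟨ +-cong (*-congʳ p) (*-congʳ q) ⟩
      a′ * b * (d * d′) + c′ * d * (b * b′)
        ≈⟨ solve 6 (λ a′ b c′ d b′ d′ → (a′ :* b) :* (d :* d′) :+ (c′ :* d) :* (b :* b′)
             := (a′ :* d′ :+ c′ :* b′) :* (b :* d)) ≈-refl a′ b c′ d b′ d′ ⟩
      (a′ * d′ + c′ * b′) * (b * d) ∎)

    *f-cong : ∀ {x x′ y y′} → x ≈f x′ → y ≈f y′ → x *f y ≈f x′ *f y′
    *f-cong {a / b [ _ ]} {a′ / b′ [ _ ]} {c / d [ _ ]} {c′ / d′ [ _ ]} (cross p) (cross q) = cross (begin
      a * c * (b′ * d′)   ≈⟨ solve 4 (λ a c b′ d′ → a :* c :* (b′ :* d′) := (a :* b′) :* (c :* d′)) ≈-refl a c b′ d′ ⟩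
      a * b′ * (c * d′)   ≈⟨ *-cong p q ⟩
      a′ * b * (c′ * d)   ≈⟨ solve 4 (λ a′ b c′ d → a′ :* b :* (c′ :* d) := a′ :* c′ :* (b :* d)) ≈-refl a′ b c′ d ⟩
      a′ * c′ * (b * d)   ∎)

    -f-cong : ∀ {x x′} → x ≈f x′ → -f x ≈f -f x′
    -f-cong {a / b [ _ ]} {a′ / b′ [ _ ]} (cross p) = cross (begin
      - a * b′    ≈⟨ -‿distribˡ-* a b′ ⟨
      - (a * b′)  ≈⟨ -‿cong p ⟩
      - (a′ * b)  ≈⟨ -‿distribˡ-* a′ b ⟩
      - a′ * b    ∎)

    +f-assoc : ∀ x y z → (x +f y) +f z ≈f x +f (y +f z)
    +f-assoc (a / b [ _ ]) (c / d [ _ ]) (e / f [ _ ]) = cross (solve 6 (λ a b c d e f →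
      ((a :* d :+ c :* b) :* f :+ e :* (b :* d)) :* (b :* (d :* f))
      := (a :* (d :* f) :+ (c :* f :+ e :* d) :* b) :* (b :* d :* f)) ≈-refl a b c d e f)

    +f-comm : ∀ x y → x +f y ≈f y +f x
    +f-comm (a / b [ _ ]) (c / d [ _ ]) = cross (solve 4 (λ a b c d →
      (a :* d :+ c :* b) :* (d :* b) := (c :* b :+ a :* d) :* (b :* d)) ≈-refl a b c d)

    *f-assoc : ∀ x y z → (x *f y) *f z ≈f x *f (y *f z)
    *f-assoc (a / b [ _ ]) (c / d [ _ ]) (e / f [ _ ]) = cross (solve 6 (λ a b c d e f →
      (a :* c :* e) :* (b :* (d :* f)) := (a :* (c :* e)) :* (b :* d :* f)) ≈-refl a b c d e f)

    *f-comm : ∀ x y → x *f y ≈f y *f x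
    *f-comm (a / b [ _ ]) (c / d [ _ ]) = cross (solve 4 (λ a b c d →
      (a :* c) :* (d :* b) := (c :* a) :* (b :* d)) ≈-refl a b c d)

    *f-distribˡ : ∀ x y z → x *f (y +f z) ≈f x *f y +f x *f z
    *f-distribˡ (a / b [ _ ]) (c / d [ _ ]) (e / f [ _ ]) = cross (solve 6 (λ a b c d e f →
      (a :* (c :* f :+ e :* d)) :* ((b :* d) :* (b :* f))
      := ((a :* c) :* (b :* f) :+ (a :* e) :* (b :* d)) :* (b :* (d :* f))) ≈-refl a b c d e f)

    0f 1f : Fraction
    0f = fromDomain 0#
    1f = fromDomain 1#

    +f-identityˡ : ∀ x → 0f +f x ≈f x
    +f-identityˡ (a / b [ _ ]) = cross (begin
      (0# * b + a * 1#) * b ≈⟨ *-congʳ (+-cong (zeroˡ b) (*-identityʳ a)) ⟩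
      (0# + a) * b          ≈⟨ *-cong (+-identityˡ a) (≈-sym (*-identityˡ b)) ⟩
      a * (1# * b)          ∎)

    *f-identityˡ : ∀ x → 1f *f x ≈f x
    *f-identityˡ (a / b [ _ ]) = cross (begin
      1# * a * b   ≈⟨ *-cong (*-identityˡ a) (≈-sym (*-identityˡ b)) ⟩
      a * (1# * b) ∎)

    -f-inverseˡ : ∀ x → (-f x) +f x ≈f 0f
    -f-inverseˡ (a / b [ _ ]) = cross (begin
      (- a * b + a * b) * 1# ≈⟨ *-identityʳ _ ⟩
      - a * b + a * b        ≈⟨ distribʳ b (- a) a ⟨
      (- a + a) * b          ≈⟨ *-congʳ (-‿inverseˡ a) ⟩
      0# * b                 ≈⟨ zeroˡ b ⟩
      0#                     ≈⟨ zeroˡ (b * b) ⟨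
      0# * (b * b)           ∎)

  fractionRing : CommutativeRing 0ℓ 0ℓ
  fractionRing = record
    { Carrier = Fraction ; _≈_ = _≈f_ ; _+_ = _+f_ ; _*_ = _*f_ ; -_ = -f_ ; 0# = 0f ; 1# = 1f
    ; isCommutativeRing = record
      { isRing = record
        { +-isAbelianGroup = record
          { isGroup = record
            { isMonoid = record
              { isSemigroup = record
                { isMagma = record
                  { isEquivalence = record
                    { refl  = cross ≈-refl
                    ; sym   = λ e → cross (≈-sym (uncross e))
                    ; trans = transf
                    }
                  ; ∙-cong = +f-cong
                  }
                ; assoc = +f-assoc
                }
              ; identity = +f-identityˡ , λ x → transf (+f-comm x 0f) (+f-identityˡ x)
              }
            ; inverse = -f-inverseˡ , λ x → transf (+f-comm x (-f x)) (-f-inverseˡ x)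
            ; ⁻¹-cong = -f-cong
            }
          ; comm = +f-comm
          }
        ; *-cong     = *f-cong
        ; *-assoc    = *f-assoc
        ; *-identity = *f-identityˡ , λ x → transf (*f-comm x 1f) (*f-identityˡ x)
        ; distrib    = *f-distribˡ , λ x y z →
            transf (*f-comm (y +f z) x) (transf (*f-distribˡ x y z)
                   (+f-cong (*f-comm x y) (*f-comm x z)))
        }
      ; *-comm = *f-comm
      }
    }

  private
    module F = CommutativeRing fractionRing
    module FG = GroupProperties F.+-group

    ≈f-dec : ∀ x y → Dec (x ≈f y)
    ≈f-dec x y = map′ (cross ∘ x∙y⁻¹≈ε⇒x≈y _ _) (x≈y⇒x∙y⁻¹≈ε ∘ uncross)
      ((num x * den y - num y * den x) ≈0?)

  fractionField : HeytingField 0ℓ 0ℓ 0ℓ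
  fractionField = record
    { _#_ = λ x y → ¬ x ≈f y
    ; isHeytingField = record
      { isHeytingCommutativeRing = record
        { isCommutativeRing   = F.isCommutativeRing
        ; isApartnessRelation = record
          { irrefl  = λ e ¬e → ¬e e
          ; sym     = λ ¬e e → ¬e (F.sym e)
          ; cotrans = cotrans
          }
        ; #⇒invertible = #⇒invertible
        ; invertible⇒# = invertible⇒#
        }
      ; tight = λ x y → decidable-stable (≈f-dec x y) , λ e ¬e → ¬e e
      }
    }
    where
    cotrans : ∀ {x y} → ¬ x ≈f y → ∀ z → (¬ x ≈f z) ⊎ (¬ z ≈f y)
    cotrans {x} {y} ¬e z with ≈f-dec x z
    ... | yes e = inj₂ (λ f → ¬e (F.trans e f))
    ... | no ¬f = inj₁ ¬f

    invertible : ∀ x → ¬ x ≈f 0f → Invertible F._≈_ 1f _*f_ x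
    invertible (a / b [ b≉0 ]) x≉0 = b / a [ a≉0 ]
      , cross (≈-trans (*-identityʳ _) (≈-trans (*-comm b a) (≈-sym (*-identityˡ _))))
      , cross (≈-trans (*-identityʳ _) (≈-trans (*-comm a b) (≈-sym (*-identityˡ _))))
      where
      a≉0 : ¬ a ≈ 0#
      a≉0 a≈0 = x≉0 (cross (≈-trans (*-identityʳ a) (≈-trans a≈0 (≈-sym (zeroˡ b)))))

    #⇒invertible : ∀ {x y} → ¬ x ≈f y → Invertible F._≈_ 1f _*f_ (x F.- y)
    #⇒invertible {x} {y} ¬e = invertible (x F.- y) (¬e ∘ FG.x∙y⁻¹≈ε⇒x≈y x y)

    1f≉0f : ¬ 1f ≈f 0f
    1f≉0f (cross e) = 1≉0 (≈-trans (≈-sym (*-identityʳ 1#)) (≈-trans e (zeroˡ 1#)))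

    invertible⇒# : ∀ {x y} → Invertible F._≈_ 1f _*f_ (x F.- y) → ¬ x ≈f y
    invertible⇒# (w , left , _) e = 1f≉0f
      (F.trans (F.sym left) (F.trans (F.*-congˡ {w} (FG.x≈y⇒x∙y⁻¹≈ε e)) (F.zeroʳ w)))

-- ℚ[X₀,…,Xₙ₋₁], built one variable at a time; the outermost variable is X₀.
ℚ[X_] : ℕ → IntegralDomain
ℚ[X zero  ] = ℚ-domain
ℚ[X suc n ] = Polynomial.polynomialDomain ℚ[X n ]

indeterminate : ∀ {n} → Fin n → IntegralDomain.Carrier ℚ[X n ]
indeterminate {suc n} zero    = Polynomial.X ℚ[X n ]
indeterminate {suc n} (suc i) = Polynomial.const ℚ[X n ] (indeterminate i)

ℚ⟨X_⟩ : ℕ → HeytingField 0ℓ 0ℓ 0ℓ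
ℚ⟨X n ⟩ = FractionField.fractionField ℚ[X n ]

-- The field ℚ(R₁₀,…,Rᵣ₀,R₁₁,…,Rᵣ₁), its 2r indeterminates listed in this order.
module InitialDataField (r : ℕ) where

  open HeytingField ℚ⟨X r ℕ.+ r ⟩ public hiding (zero)
  open CommutativeRing (HeytingCommutativeRing.commutativeRing heytingCommutativeRing) public
    using (semiring)
  open SemiringSum semiring public using (sum)
  open SemiringExp semiring public using (_^_)

  -- i : Fin r stands for α = 1 + i.
  var₀ var₁ : Fin r → Carrier
  var₀ i = FractionField.fromDomain ℚ[X r ℕ.+ r ] (indeterminate (i ↑ˡ r))
  var₁ i = FractionField.fromDomain ℚ[X r ℕ.+ r ] (indeterminate (r ↑ʳ i))

record IsQSystem (r : ℕ) (R : Fin (2 ℕ.+ r) → ℤ → InitialDataField.Carrier r) : Set where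
  open InitialDataField r
  field
    nonzero  : ∀ α n → ¬ R α n ≈ 0#
    initial₀ : ∀ i → R (suc (inject₁ i)) 0ℤ ≈ var₀ i
    initial₁ : ∀ i → R (suc (inject₁ i)) 1ℤ ≈ var₁ i
    lower    : ∀ n → R zero n ≈ 1#
    upper    : ∀ n → R (fromℕ (suc r)) n ≈ 1#
    -- With α = 1 + i, the indices below are α, α + 1 and α - 1.
    relation : ∀ (i : Fin r) n →
      R (suc (inject₁ i)) (n ℤ.+ 1ℤ) * R (suc (inject₁ i)) (n ℤ.- 1ℤ)
        ≈ R (suc (inject₁ i)) n ^ 2 + R (suc (suc i)) n * R (inject₁ (inject₁ i)) n

{-# OPTIONS --safe #-}

-- Write x n = R₁ n and H k n = R_k (n + k - 1), so that H k n plays the role of the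
-- k × k Hankel determinant of x n, x (n+1), …  Set
--   y k n = H k (n+1) / H k n,
--   q k n = y (k+1) n / y k n,
--   e k n = H (k+2) n · H k (n+1) / (H (k+1) n · H (k+1) (n+1)).
-- The Q-system is equivalent to y (k+1) (n+1) = y (k+1) n + e k n · y k (n+1), and makes
-- q, e a solution of Rutishauser's quotient-difference relations.  The polynomials
--   p₀ⁿ = 1,  p_{k+1}ⁿ = z p_kⁿ⁺¹ + q k n p_kⁿ
-- (the Hankel orthogonal polynomials, up to z ↦ -z) then satisfy
--   p_{k+1}ⁿ⁺¹ = p_{k+1}ⁿ + e k n p_kⁿ⁺¹.
-- Extending H by H (r+2) = 0 preserves the Q-system because H (r+1) = 1.  Hence e r = 0
-- and p_{r+1}ⁿ does not depend on n; it is monic with constant term y (r+1) n = 1.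
-- Finally the functional z^j ↦ (-1)^j x (n+j) kills p₁ⁿ because q 0 n = x (n+1) / x n,
-- and hence, by the recursion defining them, all p_{k+1}ⁿ.
module Submission where

open import Defs
open import Algebra.Apartness.Bundles using (HeytingCommutativeRing; HeytingField)
open import Algebra.Bundles using (CommutativeRing)
open import Data.Fin.Base using (Fin; zero; suc; fromℕ; toℕ; opposite; inject₁; fromℕ<)
open import Data.Fin.Properties using (opposite-involutive; toℕ-fromℕ; toℕ-fromℕ<; toℕ-inject₁)
open import Data.Integer.Base as ℤ using (ℤ; +_; -[1+_]; 0ℤ; 1ℤ)
import Data.Integer.Properties as ℤ
open import Data.Integer.Tactic.RingSolver using (solve-∀)
open import Data.Nat.Base as ℕ using (ℕ; _≤_; _<_; s≤s; s≤s⁻¹)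
import Data.Nat.Properties as ℕ
open import Data.Product.Base using (Σ-syntax; _×_; _,_; proj₁; proj₂)
open import Data.Sum.Base using (inj₁; inj₂)
open import Function.Base using (_∘_)
open import Relation.Binary.PropositionalEquality as ≡ using (_≡_)
import Algebra.Properties.Ring as RingProperties
import Algebra.Properties.Semiring.Exp as SemiringExp
import Algebra.Properties.Semiring.Sum as SemiringSum
import Algebra.Solver.Ring.NaturalCoefficients.Default as SemiringSolver
import Relation.Binary.Reasoning.Setoid as SetoidReasoning

-- Finite families continued to all natural indices.

module _ {a} {A : Set a} where

  -- Natural indices let one more row follow the rows 0, ..., r+1: row r+2 takes the default value,
  -- later chosen to be 0. They also make induction on the row plain.
  extend : ∀ {n} → (Fin n → A) → A → ℕ → A
  extend {ℕ.zero}  f d k         = d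
  extend {ℕ.suc n} f d ℕ.zero    = f zero
  extend {ℕ.suc n} f d (ℕ.suc k) = extend (f ∘ suc) d k

  extend-toℕ : ∀ {n} (f : Fin n → A) d i → extend f d (toℕ i) ≡ f i
  extend-toℕ f d zero    = ≡.refl
  extend-toℕ f d (suc i) = extend-toℕ (f ∘ suc) d i

  extend-length : ∀ n (f : Fin n → A) d → extend f d n ≡ d
  extend-length ℕ.zero    f d = ≡.refl
  extend-length (ℕ.suc n) f d = extend-length n (f ∘ suc) d

-- The functional z^j ↦ (-1)^j x (n+j) on coefficient sequences.

module AlternatingPairing {κ ℓ} (K : CommutativeRing κ ℓ) (x : ℤ → CommutativeRing.Carrier K) where

  open CommutativeRing K hiding (zero)
  open RingProperties ring using (-1*x≈-x)
  open SemiringExp semiring using (_^_)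
  open SemiringSum semiring
  open SetoidReasoning setoid
  open SemiringSolver commutativeSemiring using (solve; _:=_; _:+_; _:*_)

  -- N bounds the number of coefficients of u taken into account.
  ⟨_∣_⟩ : (ℕ → Carrier) → ℤ → ℕ → Carrier
  ⟨ u ∣ n ⟩ N = sum {N} (λ m → (- 1#) ^ toℕ m * u (toℕ m) * x (n ℤ.+ + toℕ m))

  ⟨⟩-cong : ∀ {u v} → (∀ j → u j ≈ v j) → ∀ n N → ⟨ u ∣ n ⟩ N ≈ ⟨ v ∣ n ⟩ N
  ⟨⟩-cong u≈v n N = sum-cong-≋ {N} (λ m → *-congʳ (*-congˡ (u≈v (toℕ m))))

  ⟨⟩-linear : ∀ u a v n N → ⟨ (λ j → u j + a * v j) ∣ n ⟩ N ≈ ⟨ u ∣ n ⟩ N + a * ⟨ v ∣ n ⟩ N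
  ⟨⟩-linear u a v n N = begin
    ⟨ (λ j → u j + a * v j) ∣ n ⟩ N
      ≈⟨ sum-cong-≋ {N} (λ m → solve 5
           (λ s u a v x → s :* (u :+ a :* v) :* x := s :* u :* x :+ a :* (s :* v :* x)) refl
           ((- 1#) ^ toℕ m) (u (toℕ m)) a (v (toℕ m)) (x (n ℤ.+ + toℕ m))) ⟩
    sum {N} (λ m → f m + a * g m)         ≈⟨ ∑-distrib-+ {N} f (λ m → a * g m) ⟩
    sum {N} f + sum {N} (λ m → a * g m)   ≈⟨ +-congˡ (*-distribˡ-sum {N} a g) ⟨
    sum {N} f + a * sum {N} g             ∎
    where
    f g : Fin N → Carrier
    f m = (- 1#) ^ toℕ m * u (toℕ m) * x (n ℤ.+ + toℕ m)
    g m = (- 1#) ^ toℕ m * v (toℕ m) * x (n ℤ.+ + toℕ m)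

  -- Multiplication by z on coefficient sequences.
  shift : (ℕ → Carrier) → ℕ → Carrier
  shift u ℕ.zero    = 0#
  shift u (ℕ.suc j) = u j

  -- A factor z moves the base point from n to n+1 and costs one sign. The vanishing constant term
  -- of `shift u` accounts for the drop in the number of coefficients.
  ⟨⟩-shift : ∀ u n N → ⟨ shift u ∣ n ⟩ (ℕ.suc N) ≈ - ⟨ u ∣ ℤ.suc n ⟩ N
  ⟨⟩-shift u n N = begin
    1# * 0# * x (n ℤ.+ + 0) + sum {N} f  ≈⟨ +-congʳ (trans (*-congʳ (zeroʳ 1#)) (zeroˡ _)) ⟩
    0# + sum {N} f                       ≈⟨ +-identityˡ _ ⟩
    sum {N} f                            ≈⟨ sum-cong-≋ {N} f≈-1*g ⟩
    sum {N} (λ m → - 1# * g m)           ≈⟨ *-distribˡ-sum {N} (- 1#) g ⟨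
    - 1# * sum {N} g                     ≈⟨ -1*x≈-x _ ⟩
    - sum {N} g                          ∎
    where
    f g : Fin N → Carrier
    f m = (- 1#) ^ ℕ.suc (toℕ m) * u (toℕ m) * x (n ℤ.+ + ℕ.suc (toℕ m))
    g m = (- 1#) ^ toℕ m * u (toℕ m) * x (ℤ.suc n ℤ.+ + toℕ m)

    index : ∀ i j → i ℤ.+ (1ℤ ℤ.+ j) ≡ (1ℤ ℤ.+ i) ℤ.+ j
    index = solve-∀

    f≈-1*g : ∀ m → f m ≈ - 1# * g m
    f≈-1*g m = begin
      f m ≈⟨ *-congˡ (reflexive (≡.cong x (index n (+ toℕ m)))) ⟩
      - 1# * (- 1#) ^ toℕ m * u (toℕ m) * x (ℤ.suc n ℤ.+ + toℕ m)
          ≈⟨ *-congʳ (*-assoc _ _ _) ⟩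
      - 1# * ((- 1#) ^ toℕ m * u (toℕ m)) * x (ℤ.suc n ℤ.+ + toℕ m)
          ≈⟨ *-assoc _ _ _ ⟩
      - 1# * g m ∎

  one : ℕ → Carrier
  one ℕ.zero    = 1#
  one (ℕ.suc j) = 0#

  ⟨⟩-one : ∀ n N → ⟨ one ∣ n ⟩ (ℕ.suc N) ≈ x n
  ⟨⟩-one n N = begin
    1# * 1# * x (n ℤ.+ + 0) + sum {N} f
      ≈⟨ +-cong (*-cong (*-identityˡ 1#) (reflexive (≡.cong x (ℤ.+-identityʳ n))))
                (trans (sum-cong-≋ {N} (λ m → trans (*-congʳ (zeroʳ _)) (zeroˡ _)))
                       (sum-replicate-zero N)) ⟩
    1# * x n + 0#  ≈⟨ trans (+-identityʳ _) (*-identityˡ _) ⟩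
    x n            ∎
    where
    f : Fin N → Carrier
    f m = (- 1#) ^ ℕ.suc (toℕ m) * 0# * x (n ℤ.+ + ℕ.suc (toℕ m))

-- Rutishauser's quotient-difference scheme.

module QuotientDifference {κ ℓ} (K : CommutativeRing κ ℓ) where

  open CommutativeRing K hiding (zero)
  open RingProperties ring using (-0#≈0#; +-cancelʳ)
  open SetoidReasoning setoid
  open SemiringSolver commutativeSemiring using (solve; _:=_; _:+_; _:*_)

  -- Fractions are written with explicit inverse factors, so cancelling or expanding one means
  -- removing or inserting a product equal to 1.
  *-unit : ∀ {a b} x → a * b ≈ 1# → x * (a * b) ≈ x
  *-unit x ab≈1 = trans (*-congˡ ab≈1) (*-identityʳ x)

  *-units : ∀ {a b a′ b′} x → a * b ≈ 1# → a′ * b′ ≈ 1# → x * (a * b) * (a′ * b′) ≈ x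
  *-units x ab≈1 a′b′≈1 = trans (*-unit _ a′b′≈1) (*-unit x ab≈1)

  -- `I` inverts `H` only up to row N, whereas the relation at k+1 = N reaches row N+1. This leaves
  -- room for that row to be zero.
  module Scheme (N : ℕ) (H I : ℕ → ℤ → Carrier)
    (H*I≈1 : ∀ {k} → k ≤ N → ∀ n → H k n * I k n ≈ 1#)
    (H₀≈1 : ∀ n → H 0 n ≈ 1#)
    (relation : ∀ {k} → k < N → ∀ n → H (ℕ.suc k) n * H (ℕ.suc k) (ℤ.suc (ℤ.suc n))
      ≈ H (ℕ.suc k) (ℤ.suc n) * H (ℕ.suc k) (ℤ.suc n)
        + H (ℕ.suc (ℕ.suc k)) n * H k (ℤ.suc (ℤ.suc n)))
    where

    -- The factor `H k n * I k (ℤ.suc n)` in `q` is 1 / y k n. In `e`, row k+2 occurs only in the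
    -- numerator, so `e k` makes sense for k+1 = N as well.
    y q e : ℕ → ℤ → Carrier
    y k n = H k (ℤ.suc n) * I k n
    q k n = y (ℕ.suc k) n * (H k n * I k (ℤ.suc n))
    e k n = H (ℕ.suc (ℕ.suc k)) n * H k (ℤ.suc n) * (I (ℕ.suc k) n * I (ℕ.suc k) (ℤ.suc n))

    y₀≈1 : ∀ n → y 0 n ≈ 1#
    y₀≈1 n = begin
      H 0 (ℤ.suc n) * I 0 n ≈⟨ *-congʳ (trans (H₀≈1 (ℤ.suc n)) (sym (H₀≈1 n))) ⟩
      H 0 n * I 0 n         ≈⟨ H*I≈1 ℕ.z≤n n ⟩
      1#                    ∎

    q*y : ∀ {k} → k ≤ N → ∀ n → q k n * y k n ≈ y (ℕ.suc k) n
    q*y {k} k≤N n = begin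
      q k n * y k n
        ≈⟨ solve 5 (λ y h i h′ i′ → y :* (h :* i′) :* (h′ :* i) := y :* (h :* i) :* (h′ :* i′)) refl
             (y (ℕ.suc k) n) (H k n) (I k n) (H k (ℤ.suc n)) (I k (ℤ.suc n)) ⟩
      y (ℕ.suc k) n * (H k n * I k n) * (H k (ℤ.suc n) * I k (ℤ.suc n))
        ≈⟨ *-units _ (H*I≈1 k≤N n) (H*I≈1 k≤N (ℤ.suc n)) ⟩
      y (ℕ.suc k) n ∎

    -- This is the relation for row k+1 divided by H (k+1) n · H (k+1) (n+1); the last term is then
    -- expanded by H k (n+1).
    y-step : ∀ {k} → k < N → ∀ n →
      y (ℕ.suc k) (ℤ.suc n) ≈ y (ℕ.suc k) n + e k n * y k (ℤ.suc n)
    y-step {k} k<N n = begin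
      a″ * i′                                      ≈⟨ *-unit _ ai ⟨
      a″ * i′ * (a * i)
        ≈⟨ solve 4 (λ a a″ i i′ → a″ :* i′ :* (a :* i) := a :* a″ :* (i :* i′)) refl a a″ i i′ ⟩
      a * a″ * (i * i′)                            ≈⟨ *-congʳ (relation k<N n) ⟩
      (a′ * a′ + g * h″) * (i * i′)
        ≈⟨ solve 5 (λ a′ g h″ i i′ → (a′ :* a′ :+ g :* h″) :* (i :* i′)
             := a′ :* i :* (a′ :* i′) :+ g :* h″ :* (i :* i′)) refl a′ g h″ i i′ ⟩
      a′ * i * (a′ * i′) + g * h″ * (i * i′)
        ≈⟨ +-cong (*-unit _ (H*I≈1 k<N (ℤ.suc n))) (sym (*-unit _ (H*I≈1 (ℕ.<⇒≤ k<N) (ℤ.suc n)))) ⟩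
      a′ * i + g * h″ * (i * i′) * (h′ * j′)
        ≈⟨ +-congˡ (solve 6 (λ g h′ h″ i i′ j′ → g :* h″ :* (i :* i′) :* (h′ :* j′)
             := g :* h′ :* (i :* i′) :* (h″ :* j′)) refl g h′ h″ i i′ j′) ⟩
      a′ * i + g * h′ * (i * i′) * (h″ * j′)       ∎
      where
      a a′ a″ i i′ g h′ h″ j′ : Carrier
      a  = H (ℕ.suc k) n
      a′ = H (ℕ.suc k) (ℤ.suc n)
      a″ = H (ℕ.suc k) (ℤ.suc (ℤ.suc n))
      i  = I (ℕ.suc k) n
      i′ = I (ℕ.suc k) (ℤ.suc n)
      g  = H (ℕ.suc (ℕ.suc k)) n
      h′ = H k (ℤ.suc n)
      h″ = H k (ℤ.suc (ℤ.suc n))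
      j′ = I k (ℤ.suc n)
      ai = H*I≈1 k<N n

    -- The multiplicative quotient-difference relation. It is pure cancellation: both sides reduce
    -- to H (k+2) (n+1) · H k (n+1) / H (k+1) (n+1)².
    e*q : ∀ {k} → ℕ.suc k < N → ∀ n →
      e k (ℤ.suc n) * q k (ℤ.suc n) ≈ q (ℕ.suc k) n * e k n
    e*q {k} 1+k<N n = begin
      b′ * h″ * (i′ * i″) * (a″ * i′ * (h′ * j″))
        ≈⟨ solve 7 (λ b′ h′ h″ j″ a″ i′ i″ → b′ :* h″ :* (i′ :* i″) :* (a″ :* i′ :* (h′ :* j″))
             := b′ :* h′ :* (i′ :* i′) :* (h″ :* j″) :* (a″ :* i″)) refl b′ h′ h″ j″ a″ i′ i″ ⟩
      b′ * h′ * (i′ * i′) * (h″ * j″) * (a″ * i″)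
        ≈⟨ *-units _ (H*I≈1 (ℕ.<⇒≤ k<N) (ℤ.suc (ℤ.suc n))) (H*I≈1 k<N (ℤ.suc (ℤ.suc n))) ⟩
      b′ * h′ * (i′ * i′)
        ≈⟨ *-units _ (H*I≈1 1+k<N n) (H*I≈1 k<N n) ⟨
      b′ * h′ * (i′ * i′) * (b * l) * (a * i)
        ≈⟨ solve 7 (λ b′ h′ b l a i i′ → b′ :* h′ :* (i′ :* i′) :* (b :* l) :* (a :* i)
             := b′ :* l :* (a :* i′) :* (b :* h′ :* (i :* i′))) refl b′ h′ b l a i i′ ⟩
      b′ * l * (a * i′) * (b * h′ * (i * i′)) ∎
      where
      k<N = ℕ.<⇒≤ 1+k<N
      a a″ b b′ h′ h″ i i′ i″ j″ l : Carrier
      a  = H (ℕ.suc k) n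
      a″ = H (ℕ.suc k) (ℤ.suc (ℤ.suc n))
      b  = H (ℕ.suc (ℕ.suc k)) n
      b′ = H (ℕ.suc (ℕ.suc k)) (ℤ.suc n)
      h′ = H k (ℤ.suc n)
      h″ = H k (ℤ.suc (ℤ.suc n))
      i  = I (ℕ.suc k) n
      i′ = I (ℕ.suc k) (ℤ.suc n)
      i″ = I (ℕ.suc k) (ℤ.suc (ℤ.suc n))
      j″ = I k (ℤ.suc (ℤ.suc n))
      l  = I (ℕ.suc (ℕ.suc k)) n

    y-cancelʳ : ∀ {k} → k ≤ N → ∀ n {u v} → u * y k n ≈ v * y k n → u ≈ v
    y-cancelʳ {k} k≤N n {u} {v} uy≈vy = begin
      u               ≈⟨ y-inverse u ⟨
      u * y k n * w   ≈⟨ *-congʳ uy≈vy ⟩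
      v * y k n * w   ≈⟨ y-inverse v ⟩
      v               ∎
      where
      -- `w` is the inverse of `y k n`.
      w = H k n * I k (ℤ.suc n)
      y-inverse : ∀ u → u * y k n * w ≈ u
      y-inverse u = begin
        u * y k n * w
          ≈⟨ solve 5 (λ u h i h′ i′ → u :* (h′ :* i) :* (h :* i′) := u :* (h :* i) :* (h′ :* i′)) refl
               u (H k n) (I k n) (H k (ℤ.suc n)) (I k (ℤ.suc n)) ⟩
        u * (H k n * I k n) * (H k (ℤ.suc n) * I k (ℤ.suc n))
          ≈⟨ *-units u (H*I≈1 k≤N n) (H*I≈1 k≤N (ℤ.suc n)) ⟩
        u ∎

    -- The boundary case of the additive relation, where an e of index -1 would count as 0. As y 0
    -- is constantly 1, `y-step` at k = 0 is already a statement about q 0.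
    q₀-step : 0 < N → ∀ n → q 0 (ℤ.suc n) ≈ q 0 n + e 0 n
    q₀-step 0<N n = y-cancelʳ ℕ.z≤n (ℤ.suc n) (begin
      q 0 (ℤ.suc n) * y 0 (ℤ.suc n)              ≈⟨ q*y ℕ.z≤n (ℤ.suc n) ⟩
      y 1 (ℤ.suc n)                              ≈⟨ y-step 0<N n ⟩
      y 1 n + e 0 n * y 0 (ℤ.suc n)              ≈⟨ +-congʳ (q*y ℕ.z≤n n) ⟨
      q 0 n * y 0 n + e 0 n * y 0 (ℤ.suc n)
        ≈⟨ +-congʳ (*-congˡ (trans (y₀≈1 n) (sym (y₀≈1 (ℤ.suc n))))) ⟩
      q 0 n * y 0 (ℤ.suc n) + e 0 n * y 0 (ℤ.suc n) ≈⟨ distribʳ _ _ _ ⟨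
      (q 0 n + e 0 n) * y 0 (ℤ.suc n)            ∎)

    -- The additive quotient-difference relation, checked after multiplication by y (k+1) (n+1).
    -- `q*y` and `e*q` extract the common factor q (k+1) n; `y-step` at k+1 produces e (k+1) n, and
    -- `y-step` at k reassembles y (k+1) (n+1).
    q-step : ∀ {k} → ℕ.suc k < N → ∀ n →
      e k (ℤ.suc n) + q (ℕ.suc k) (ℤ.suc n) ≈ q (ℕ.suc k) n + e (ℕ.suc k) n
    q-step {k} 1+k<N n = y-cancelʳ k<N (ℤ.suc n) (begin
      (e k n′ + q k′ n′) * y k′ n′                    ≈⟨ distribʳ _ _ _ ⟩
      e k n′ * y k′ n′ + q k′ n′ * y k′ n′
        ≈⟨ +-cong (*-congˡ (sym (q*y (ℕ.<⇒≤ k<N) n′))) (trans (q*y k<N n′) (y-step 1+k<N n)) ⟩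
      e k n′ * (q k n′ * y k n′) + (y (ℕ.suc k′) n + e k′ n * y k′ n′)
        ≈⟨ +-cong (trans (sym (*-assoc _ _ _)) (*-congʳ (e*q 1+k<N n))) (+-congʳ (sym (q*y k<N n))) ⟩
      q k′ n * e k n * y k n′ + (q k′ n * y k′ n + e k′ n * y k′ n′)
        ≈⟨ solve 6 (λ q e y₁ y₂ e′ y₃ → q :* e :* y₁ :+ (q :* y₂ :+ e′ :* y₃)
             := q :* (y₂ :+ e :* y₁) :+ e′ :* y₃) refl
             (q k′ n) (e k n) (y k n′) (y k′ n) (e k′ n) (y k′ n′) ⟩
      q k′ n * (y k′ n + e k n * y k n′) + e k′ n * y k′ n′
        ≈⟨ +-congʳ (*-congˡ (y-step k<N n)) ⟨
      q k′ n * y k′ n′ + e k′ n * y k′ n′              ≈⟨ distribʳ _ _ _ ⟨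
      (q k′ n + e k′ n) * y k′ n′                      ∎)
      where
      k′  = ℕ.suc k
      n′  = ℤ.suc n
      k<N = ℕ.<⇒≤ 1+k<N

    -- The orthogonal polynomials of the scheme.

    open AlternatingPairing K (H 1)

    p : ℕ → ℤ → ℕ → Carrier
    p ℕ.zero    n j = one j
    p (ℕ.suc k) n j = shift (p k (ℤ.suc n)) j + q k n * p k n j

    shift-linear : ∀ {u v w : ℕ → Carrier} {a} → (∀ j → u j ≈ v j + a * w j) →
      ∀ j → shift u j ≈ shift v j + a * shift w j
    shift-linear u≈ ℕ.zero    = sym (trans (+-identityˡ _) (zeroʳ _))
    shift-linear u≈ (ℕ.suc j) = u≈ j

    -- Induction on k with base `q₀-step`. The hypothesis is used twice: under `shift` at n+1, and
    -- at n for the factor of q. The relations `q-step` and `e*q` then match the coefficients.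
    p-step : ∀ {k} → k < N → ∀ n j →
      p (ℕ.suc k) (ℤ.suc n) j ≈ p (ℕ.suc k) n j + e k n * p k (ℤ.suc n) j
    p-step {ℕ.zero} 0<N n j = begin
      shift one j + q 0 (ℤ.suc n) * one j            ≈⟨ +-congˡ (*-congʳ (q₀-step 0<N n)) ⟩
      shift one j + (q 0 n + e 0 n) * one j
        ≈⟨ solve 4 (λ s q e u → s :+ (q :+ e) :* u := s :+ q :* u :+ e :* u) refl
             (shift one j) (q 0 n) (e 0 n) (one j) ⟩
      shift one j + q 0 n * one j + e 0 n * one j    ∎
    p-step {ℕ.suc k} 1+k<N n j = begin
      z″ + q k′ n′ * p′
        ≈⟨ +-congʳ (shift-linear (p-step k<N n′) j) ⟩
      z′ + e k n′ * zₖ + q k′ n′ * p′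
        ≈⟨ +-cancelʳ _ _ _ cancelled ⟩
      z′ + q k′ n * p₀ + e k′ n * p′ ∎
      where
      k′  = ℕ.suc k
      n′  = ℤ.suc n
      k<N = ℕ.<⇒≤ 1+k<N
      p₀ p′ pₖ z′ z″ zₖ : Carrier
      p₀ = p k′ n j
      p′ = p k′ n′ j
      pₖ = p k n′ j
      z′ = shift (p k′ n′) j
      z″ = shift (p k′ (ℤ.suc n′)) j
      zₖ = shift (p k (ℤ.suc n′)) j

      -- Adding this multiple of pₖ turns e k n′ * zₖ into a multiple of p′ = zₖ + q k n′ * pₖ.
      cancelled : z′ + e k n′ * zₖ + q k′ n′ * p′ + e k n′ * q k n′ * pₖ
                ≈ z′ + q k′ n * p₀ + e k′ n * p′ + e k n′ * q k n′ * pₖ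
      cancelled = begin
        z′ + e k n′ * zₖ + q k′ n′ * p′ + e k n′ * q k n′ * pₖ
          ≈⟨ solve 6 (λ z′ e zₖ q′ qₖ pₖ →
               z′ :+ e :* zₖ :+ q′ :* (zₖ :+ qₖ :* pₖ) :+ e :* qₖ :* pₖ
               := z′ :+ (e :+ q′) :* (zₖ :+ qₖ :* pₖ)) refl
               z′ (e k n′) zₖ (q k′ n′) (q k n′) pₖ ⟩
        z′ + (e k n′ + q k′ n′) * p′             ≈⟨ +-congˡ (*-congʳ (q-step 1+k<N n)) ⟩
        z′ + (q k′ n + e k′ n) * p′
          ≈⟨ solve 4 (λ z′ q e p′ → z′ :+ (q :+ e) :* p′ := z′ :+ q :* p′ :+ e :* p′) refl
               z′ (q k′ n) (e k′ n) p′ ⟩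
        z′ + q k′ n * p′ + e k′ n * p′
          ≈⟨ +-congʳ (+-congˡ (*-congˡ (p-step k<N n j))) ⟩
        z′ + q k′ n * (p₀ + e k n * pₖ) + e k′ n * p′
          ≈⟨ solve 6 (λ z′ q p₀ e pₖ ep → z′ :+ q :* (p₀ :+ e :* pₖ) :+ ep
               := z′ :+ q :* p₀ :+ ep :+ q :* e :* pₖ) refl
               z′ (q k′ n) p₀ (e k n) pₖ (e k′ n * p′) ⟩
        z′ + q k′ n * p₀ + e k′ n * p′ + q k′ n * e k n * pₖ
          ≈⟨ +-congˡ (*-congʳ (e*q 1+k<N n)) ⟨
        z′ + q k′ n * p₀ + e k′ n * p′ + e k n′ * q k n′ * pₖ ∎

    -- The shifted summand has no constant term, so a product of q's remains. It telescopes to y k n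
    -- because y 0 = 1.
    p-constantTerm : ∀ {k} → k ≤ N → ∀ n → p k n 0 ≈ y k n
    p-constantTerm {ℕ.zero}  _   n = sym (y₀≈1 n)
    p-constantTerm {ℕ.suc k} k<N n = begin
      0# + q k n * p k n 0  ≈⟨ +-identityˡ _ ⟩
      q k n * p k n 0       ≈⟨ *-congˡ (p-constantTerm (ℕ.<⇒≤ k<N) n) ⟩
      q k n * y k n         ≈⟨ q*y (ℕ.<⇒≤ k<N) n ⟩
      y (ℕ.suc k) n         ∎

    p-degree : ∀ {k j} → k < j → ∀ n → p k n j ≈ 0#
    p-degree {ℕ.zero}  {ℕ.suc j} _   n = refl
    p-degree {ℕ.suc k} {ℕ.suc j} k<j n = begin
      p k (ℤ.suc n) j + q k n * p k n (ℕ.suc j)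
        ≈⟨ +-cong (p-degree (s≤s⁻¹ k<j) (ℤ.suc n)) (*-congˡ (p-degree (ℕ.<⇒≤ k<j) n)) ⟩
      0# + q k n * 0#  ≈⟨ trans (+-identityˡ _) (zeroʳ _) ⟩
      0#               ∎

    p-monic : ∀ k n → p k n k ≈ 1#
    p-monic ℕ.zero    n = refl
    p-monic (ℕ.suc k) n = begin
      p k (ℤ.suc n) k + q k n * p k n (ℕ.suc k)
        ≈⟨ +-cong (p-monic k (ℤ.suc n)) (*-congˡ (p-degree (ℕ.n<1+n k) n)) ⟩
      1# + q k n * 0#  ≈⟨ trans (+-congˡ (zeroʳ _)) (+-identityʳ _) ⟩
      1#               ∎

    q₀*H₁ : 0 < N → ∀ n → q 0 n * H 1 n ≈ H 1 (ℤ.suc n)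
    q₀*H₁ 0<N n = begin
      q 0 n * H 1 n
        ≈⟨ solve 5 (λ x′ i h₀ i₀ x → x′ :* i :* (h₀ :* i₀) :* x := x′ :* (x :* i) :* (h₀ :* i₀)) refl
             (H 1 (ℤ.suc n)) (I 1 n) (H 0 n) (I 0 (ℤ.suc n)) (H 1 n) ⟩
      H 1 (ℤ.suc n) * (H 1 n * I 1 n) * (H 0 n * I 0 (ℤ.suc n))
        ≈⟨ *-units _ (H*I≈1 0<N n)
             -- H 0 n may be traded for H 0 (n+1), both being 1, and the latter is inverted by I 0
             -- (n+1).
             (trans (*-congʳ (trans (H₀≈1 n) (sym (H₀≈1 (ℤ.suc n))))) (H*I≈1 ℕ.z≤n (ℤ.suc n))) ⟩
      H 1 (ℤ.suc n) ∎

    -- By `⟨⟩-shift` the summand z p_kⁿ⁺¹ pairs at base point n+1, so for k > 0 both summands vanish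
    -- by induction; for k = 0 they cancel by `q₀*H₁`. The bound on M keeps all coefficients of
    -- p_{k+1} in the truncated sum.
    p-orthogonal : 0 < N → ∀ k {M} → ℕ.suc k < M → ∀ n → ⟨ p (ℕ.suc k) n ∣ n ⟩ M ≈ 0#
    p-orthogonal 0<N k {ℕ.suc M} (s≤s k<M) n = begin
      ⟨ p (ℕ.suc k) n ∣ n ⟩ (ℕ.suc M)
        ≈⟨ ⟨⟩-linear (shift (p k (ℤ.suc n))) (q k n) (p k n) n (ℕ.suc M) ⟩
      ⟨ shift (p k (ℤ.suc n)) ∣ n ⟩ (ℕ.suc M) + q k n * ⟨ p k n ∣ n ⟩ (ℕ.suc M)
        ≈⟨ +-congʳ (⟨⟩-shift (p k (ℤ.suc n)) n M) ⟩
      - ⟨ p k (ℤ.suc n) ∣ ℤ.suc n ⟩ M + q k n * ⟨ p k n ∣ n ⟩ (ℕ.suc M)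
        ≈⟨ remainder k k<M ⟩
      0# ∎
      where
      remainder : ∀ k {M} → k < M →
        - ⟨ p k (ℤ.suc n) ∣ ℤ.suc n ⟩ M + q k n * ⟨ p k n ∣ n ⟩ (ℕ.suc M) ≈ 0#
      remainder ℕ.zero {ℕ.suc M} _ = begin
        - ⟨ one ∣ ℤ.suc n ⟩ (ℕ.suc M) + q 0 n * ⟨ one ∣ n ⟩ (ℕ.suc (ℕ.suc M))
          ≈⟨ +-cong (-‿cong (⟨⟩-one (ℤ.suc n) M)) (*-congˡ (⟨⟩-one n (ℕ.suc M))) ⟩
        - H 1 (ℤ.suc n) + q 0 n * H 1 n   ≈⟨ +-congˡ (q₀*H₁ 0<N n) ⟩
        - H 1 (ℤ.suc n) + H 1 (ℤ.suc n)   ≈⟨ -‿inverseˡ _ ⟩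
        0#                                ∎
      remainder (ℕ.suc k) {M} k<M = begin
        - ⟨ p (ℕ.suc k) (ℤ.suc n) ∣ ℤ.suc n ⟩ M + q (ℕ.suc k) n * ⟨ p (ℕ.suc k) n ∣ n ⟩ (ℕ.suc M)
          ≈⟨ +-cong (-‿cong (p-orthogonal 0<N k k<M (ℤ.suc n)))
                    (*-congˡ (p-orthogonal 0<N k (ℕ.m<n⇒m<1+n k<M) n)) ⟩
        - 0# + q (ℕ.suc k) n * 0#  ≈⟨ +-cong -0#≈0# (zeroʳ _) ⟩
        0# + 0#                    ≈⟨ +-identityˡ 0# ⟩
        0#                         ∎

  -- The linear recursion for a Q-system with invertible entries.

  stationary : ∀ (f : ℤ → Carrier) → (∀ n → f (ℤ.suc n) ≈ f n) → ∀ n → f n ≈ f 0ℤ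
  stationary f f-step (+ ℕ.zero)     = refl
  stationary f f-step (+ ℕ.suc n)    = trans (f-step (+ n)) (stationary f f-step (+ n))
  stationary f f-step -[1+ ℕ.zero ]  = sym (f-step -[1+ 0 ])
  stationary f f-step -[1+ ℕ.suc n ] =
    trans (sym (f-step -[1+ ℕ.suc n ])) (stationary f f-step -[1+ n ])

  open SemiringExp semiring using (_^_)
  open SemiringSum semiring using (sum; sum-cong-≋)

  module _ (r : ℕ) (R R⁻¹ : Fin (2 ℕ.+ r) → ℤ → Carrier)
    (inverse : ∀ α n → R α n * R⁻¹ α n ≈ 1#)
    (lower : ∀ n → R zero n ≈ 1#)
    (upper : ∀ n → R (fromℕ (ℕ.suc r)) n ≈ 1#)
    (relation : ∀ (i : Fin r) n →
      R (suc (inject₁ i)) (n ℤ.+ 1ℤ) * R (suc (inject₁ i)) (n ℤ.- 1ℤ)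
        ≈ R (suc (inject₁ i)) n ^ 2 + R (suc (suc i)) n * R (inject₁ (inject₁ i)) n)
    where

    private
      N : ℕ
      N = ℕ.suc r

      row row⁻¹ : ℕ → ℤ → Carrier
      row   = extend R   (λ _ → 0#)
      row⁻¹ = extend R⁻¹ (λ _ → 0#)

      H I : ℕ → ℤ → Carrier
      H k n = row   k (n ℤ.+ + k ℤ.- 1ℤ)
      I k n = row⁻¹ k (n ℤ.+ + k ℤ.- 1ℤ)

      row-toℕ : ∀ {k} α → toℕ α ≡ k → ∀ n → row k n ≈ R α n
      row-toℕ α ≡.refl n = reflexive (≡.cong-app (extend-toℕ R _ α) n)

      row⁻¹-toℕ : ∀ {k} α → toℕ α ≡ k → ∀ n → row⁻¹ k n ≈ R⁻¹ α n
      row⁻¹-toℕ α ≡.refl n = reflexive (≡.cong-app (extend-toℕ R⁻¹ _ α) n)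

      row-N : ∀ n → row N n ≈ 1#
      row-N n = trans (row-toℕ (fromℕ N) (toℕ-fromℕ N) n) (upper n)

      row-1+N : ∀ n → row (ℕ.suc N) n ≈ 0#
      row-1+N n = reflexive (≡.cong-app (extend-length (ℕ.suc N) R _) n)

      H*I≈1 : ∀ {k} → k ≤ N → ∀ n → H k n * I k n ≈ 1#
      H*I≈1 k≤N n = trans (*-cong (row-toℕ α toℕ-α _) (row⁻¹-toℕ α toℕ-α _)) (inverse α _)
        where
        α = fromℕ< (s≤s k≤N)
        toℕ-α = toℕ-fromℕ< (s≤s k≤N)

      row-relation : ∀ {k} → k < N → ∀ m →
        row (ℕ.suc k) (m ℤ.- 1ℤ) * row (ℕ.suc k) (m ℤ.+ 1ℤ)
          ≈ row (ℕ.suc k) m * row (ℕ.suc k) m + row (ℕ.suc (ℕ.suc k)) m * row k m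
      row-relation {k} k<N m with ℕ.m<1+n⇒m<n∨m≡n k<N
      ... | inj₁ k<r = begin
        row k′ (m ℤ.- 1ℤ) * row k′ (m ℤ.+ 1ℤ)
          ≈⟨ trans (*-comm _ _) (*-cong (row-k′ _) (row-k′ _)) ⟩
        R (suc (inject₁ i)) (m ℤ.+ 1ℤ) * R (suc (inject₁ i)) (m ℤ.- 1ℤ)
          ≈⟨ relation i m ⟩
        R (suc (inject₁ i)) m ^ 2 + R (suc (suc i)) m * R (inject₁ (inject₁ i)) m
          ≈⟨ +-cong (trans (*-congˡ (*-identityʳ _)) (*-cong (sym (row-k′ m)) (sym (row-k′ m))))
               (*-cong (sym (row-toℕ (suc (suc i)) (≡.cong (ℕ.suc ∘ ℕ.suc) toℕ-i) m))
                       (sym (row-toℕ (inject₁ (inject₁ i))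
                              (≡.trans (toℕ-inject₁ (inject₁ i)) toℕ-inject₁-i) m))) ⟩
        row k′ m * row k′ m + row (ℕ.suc k′) m * row k m ∎
        where
        k′ = ℕ.suc k
        i = fromℕ< k<r
        toℕ-i = toℕ-fromℕ< k<r
        toℕ-inject₁-i = ≡.trans (toℕ-inject₁ i) toℕ-i
        row-k′ : ∀ n → row k′ n ≈ R (suc (inject₁ i)) n
        row-k′ = row-toℕ (suc (inject₁ i)) (≡.cong ℕ.suc toℕ-inject₁-i)
      -- At the added top level the relation reads 1 · 1 = 1 · 1 + 0: row r+1 is constantly 1 and
      -- row r+2 is the default 0.
      ... | inj₂ ≡.refl = begin
        row N (m ℤ.- 1ℤ) * row N (m ℤ.+ 1ℤ)
          ≈⟨ *-cong (trans (row-N _) (sym (row-N m))) (trans (row-N _) (sym (row-N m))) ⟩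
        row N m * row N m               ≈⟨ +-identityʳ _ ⟨
        row N m * row N m + 0#          ≈⟨ +-congˡ (trans (*-congʳ (row-1+N m)) (zeroˡ _)) ⟨
        row N m * row N m + row (ℕ.suc N) m * row r m ∎

      H-relation : ∀ {k} → k < N → ∀ n → H (ℕ.suc k) n * H (ℕ.suc k) (ℤ.suc (ℤ.suc n))
        ≈ H (ℕ.suc k) (ℤ.suc n) * H (ℕ.suc k) (ℤ.suc n)
          + H (ℕ.suc (ℕ.suc k)) n * H k (ℤ.suc (ℤ.suc n))
      H-relation {k} k<N n = begin
        H k′ n * H k′ (ℤ.suc (ℤ.suc n))
          ≈⟨ *-congˡ (reflexive (≡.cong (row k′) (index₁ n (+ k)))) ⟩
        row k′ (m ℤ.- 1ℤ) * row k′ (m ℤ.+ 1ℤ)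
          ≈⟨ row-relation k<N m ⟩
        row k′ m * row k′ m + row (ℕ.suc k′) m * row k m
          ≈⟨ reflexive (≡.cong₂ _+_
               (≡.cong (λ i → row k′ i * row k′ i) (index₂ n (+ k)))
               (≡.cong₂ (λ i j → row (ℕ.suc k′) i * row k j) (index₃ n (+ k)) (index₄ n (+ k)))) ⟨
        H k′ (ℤ.suc n) * H k′ (ℤ.suc n) + H (ℕ.suc k′) n * H k (ℤ.suc (ℤ.suc n)) ∎
        where
        k′ = ℕ.suc k
        -- The common argument at which H (k+1) (n+1), H (k+2) n and H k (n+2) read their rows.
        m = n ℤ.+ (1ℤ ℤ.+ + k)
        index₁ : ∀ n k → (1ℤ ℤ.+ (1ℤ ℤ.+ n)) ℤ.+ (1ℤ ℤ.+ k) ℤ.- 1ℤ ≡ (n ℤ.+ (1ℤ ℤ.+ k)) ℤ.+ 1ℤ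
        index₁ = solve-∀
        index₂ : ∀ n k → (1ℤ ℤ.+ n) ℤ.+ (1ℤ ℤ.+ k) ℤ.- 1ℤ ≡ n ℤ.+ (1ℤ ℤ.+ k)
        index₂ = solve-∀
        index₃ : ∀ n k → n ℤ.+ (1ℤ ℤ.+ (1ℤ ℤ.+ k)) ℤ.- 1ℤ ≡ n ℤ.+ (1ℤ ℤ.+ k)
        index₃ = solve-∀
        index₄ : ∀ n k → (1ℤ ℤ.+ (1ℤ ℤ.+ n)) ℤ.+ k ℤ.- 1ℤ ≡ n ℤ.+ (1ℤ ℤ.+ k)
        index₄ = solve-∀

      open Scheme N H I H*I≈1 (λ n → lower _) H-relation
      open AlternatingPairing K (H 1) using (⟨_∣_⟩; ⟨⟩-cong)

      p-stationary : ∀ n j → p N n j ≈ p N 0ℤ j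
      p-stationary n j = stationary (λ n → p N n j) step n
        where
        step : ∀ n → p N (ℤ.suc n) j ≈ p N n j
        step n = begin
          p N (ℤ.suc n) j                          ≈⟨ p-step ℕ.≤-refl n j ⟩
          p N n j + e r n * p r (ℤ.suc n) j
            -- The first factor of e r n is H (r+2) n = 0.
            ≈⟨ +-congˡ (*-congʳ (trans (*-congʳ (trans (*-congʳ (row-1+N _)) (zeroˡ _))) (zeroˡ _))) ⟩
          p N n j + 0# * p r (ℤ.suc n) j           ≈⟨ +-congˡ (zeroˡ _) ⟩
          p N n j + 0#                             ≈⟨ +-identityʳ _ ⟩
          p N n j                                  ∎

      H₁≡R₁ : ∀ n → H 1 n ≡ R (suc zero) n
      H₁≡R₁ n = ≡.cong (R (suc zero)) (index n)
        where
        index : ∀ n → n ℤ.+ 1ℤ ℤ.- 1ℤ ≡ n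
        index = solve-∀

    linearRecursion : Σ[ c ∈ (Fin (2 ℕ.+ r) → Carrier) ]
      c zero ≈ 1# × c (fromℕ (ℕ.suc r)) ≈ 1# ×
      ((n : ℤ) → sum {2 ℕ.+ r}
        (λ m → (- 1#) ^ toℕ m * c (opposite m) * R (suc zero) (n ℤ.+ + toℕ m)) ≈ 0#)
    linearRecursion = c , c₀≈1 , c-last≈1 , recursion
      where
      c : Fin (2 ℕ.+ r) → Carrier
      -- Reversed because c_{r+1-m} multiplies x (n+m): c zero is the leading coefficient and the
      -- last c the constant term.
      c i = p N 0ℤ (toℕ (opposite i))

      c₀≈1 : c zero ≈ 1#
      c₀≈1 = trans (reflexive (≡.cong (p N 0ℤ) (toℕ-fromℕ N))) (p-monic N 0ℤ)

      c-last≈1 : c (fromℕ N) ≈ 1#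
      c-last≈1 = begin
        p N 0ℤ (toℕ (opposite (fromℕ N)))
          ≈⟨ reflexive (≡.cong (p N 0ℤ ∘ toℕ) (opposite-involutive {2 ℕ.+ r} zero)) ⟩
        p N 0ℤ 0        ≈⟨ p-constantTerm ℕ.≤-refl 0ℤ ⟩
        -- This is y N 0, and row N is constantly 1.
        H N 1ℤ * I N 0ℤ ≈⟨ *-congʳ (trans (row-N _) (sym (row-N _))) ⟩
        H N 0ℤ * I N 0ℤ ≈⟨ H*I≈1 ℕ.≤-refl 0ℤ ⟩
        1#              ∎

      recursion : ∀ n → sum {2 ℕ.+ r}
        (λ m → (- 1#) ^ toℕ m * c (opposite m) * R (suc zero) (n ℤ.+ + toℕ m)) ≈ 0#
      recursion n = begin
        sum {2 ℕ.+ r} (λ m → (- 1#) ^ toℕ m * c (opposite m) * R (suc zero) (n ℤ.+ + toℕ m))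
          ≈⟨ sum-cong-≋ {2 ℕ.+ r} (λ m → *-cong
               (*-congˡ {(- 1#) ^ toℕ m} (reflexive (≡.cong (p N 0ℤ ∘ toℕ) (opposite-involutive m))))
               (reflexive (≡.sym (H₁≡R₁ (n ℤ.+ + toℕ m))))) ⟩
        -- The functional at n kills the polynomial at the same n, so stationarity first replaces
        -- index 0 by n. Degree N = r+1 needs exactly r+2 coefficients.
        ⟨ p N 0ℤ ∣ n ⟩ (2 ℕ.+ r)   ≈⟨ ⟨⟩-cong (p-stationary n) n (2 ℕ.+ r) ⟨
        ⟨ p N n ∣ n ⟩ (2 ℕ.+ r)    ≈⟨ p-orthogonal (ℕ.s≤s ℕ.z≤n) r ℕ.≤-refl n ⟩
        0#                         ∎

-- Specialisation to the field of rational functions.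

mainTheorem2 : (r : ℕ) → 1 ≤ r → let open InitialDataField r in
    (R : Fin (2 ℕ.+ r) → ℤ → Carrier) → IsQSystem r R →
    Σ[ c ∈ (Fin (2 ℕ.+ r) → Carrier) ] c zero ≈ 1# × c (fromℕ (ℕ.suc r)) ≈ 1# ×
    ((n : ℤ) → sum {2 ℕ.+ r} (λ m → (- 1#) ^ toℕ m * c (opposite m) * R (suc zero) (n ℤ.+ + toℕ m)) ≈ 0#)
mainTheorem2 r _ R isQSystem =
  QuotientDifference.linearRecursion K r R (λ α n → proj₁ (R-invertible α n)) inverse
    lower upper relation
  where
  open IsQSystem isQSystem
  K = HeytingCommutativeRing.commutativeRing (HeytingField.heytingCommutativeRing ℚ⟨X r ℕ.+ r ⟩)
  open HeytingField ℚ⟨X r ℕ.+ r ⟩ using (#⇒invertible; _≈_; _*_; 0#; 1#)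
  open CommutativeRing K using (trans; sym; *-congʳ; +-congˡ; +-identityʳ)
  open RingProperties (CommutativeRing.ring K) using (-0#≈0#)
  -- Apartness in this field is negated equality, so `nonzero` yields an inverse of R α n - 0;
  -- `inverse` then removes the subtraction of 0.
  R-invertible = λ α n → #⇒invertible {R α n} {0#} (nonzero α n)
  inverse : ∀ α n → R α n * proj₁ (R-invertible α n) ≈ 1#
  inverse α n = trans
    (*-congʳ {proj₁ (R-invertible α n)} (sym (trans (+-congˡ {R α n} -0#≈0#) (+-identityʳ (R α n)))))
    (proj₂ (proj₂ (R-invertible α n)))
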